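{- Let $\mathbb{C}$ be a small category, let $F\colon \widehat{\mathbb{C}} \to \widehat{\mathbb{C}}$ be a functor preserving intersections and inverse images, and let $c\colon C \to FC$ be an $F$-coalgebra. Then the following statements are equivalent: (1) $c$ is recursive; (2) $c$ is well-founded; (3) the graph of $c$ is well-founded, i.e. it contains no infinite path.
   Context: $\widehat{\mathbb{C}} = \mathbf{Set}^{\mathbb{C}^{\mathrm{op}}}$ is the presheaf category. An intersection is a wide pullback of monomorphisms with common codomain (an arbitrary product, in a slice category, of monomorphisms). The inverse image of a monomorphism $m\colon A\to B$ under $f\colon X\to B$ is the monomorphism obtained by pulling back $m$ along $f$. $F$ preserves these if it sends the corresponding (wide) pullback diagrams to (wide) pullback diagrams; in particular such an $F$ preserves monomorphisms, so for a subpresheaf $B\hookrightarrow C$ we regard $F(B)(x)$ as a subset of $F(C)(x)$. For a coalgebra $c\colon C\to FC$ and an algebra $a\colon FA\to A$, a ca-morphism (coalgebra-to-algebra morphism) from $c$ to $a$ is a morphism $i\colon C\to A$ with $i = a\circ Fi\circ c$. The coalgebra $c$ is recursive if for every $F$-algebra $a$ there is a unique ca-morphism from $c$ to $a$. The coalgebra $c$ is well-founded if every monomorphism $i\colon A\rightarrowtail C$ for which there is a morphism $b\colon A\to FA$ making the square $Fi\circ b = c\circ i$ a pullback (of $Fi$ along $c$) is an isomorphism. For $x\in\mathbb{C}$ and $n\in C(x)$, let $A^c_{(x,n)}$ be the subpresheaf of $C$ given by $A^c_{(x,n)} = \bigcap\{B \mid B\hookrightarrow C \text{ a subpresheaf},\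 c_x(n)\in F(B)(x)\}$. The graph of $c$ is the directed graph whose nodes are the pairs $(x,n)$ with $x\in\mathbb{C}$ and $n\in C(x)$, and which has an edge $(x,n)\to(y,m)$ if and only if $m\in A^c_{(x,n)}(y)$. -}

module Defs where

open import Level using (Level; _⊔_; suc)
open import Data.Nat.Base as ℕ using (ℕ)
open import Data.Product using (Σ; Σ-syntax; ∃; ∃!; ∃-syntax; _×_; _,_; proj₁; proj₂)
open import Function.Bundles using (Func)
import Function.Construct.Composition as Composition
import Function.Construct.Identity as Identity
import Function.Relation.Binary.Setoid.Equality as FuncEquality
open import Relation.Binary.Bundles using (Setoid)
open import Relation.Binary.Core using (Rel)
open import Relation.Binary.Structures using (IsEquivalence)
open import Relation.Nullary.Negation using (¬_)

------------------------------------------------------------------------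
-- Categories, functors, natural transformations.
-- Hom-sets are setoids, so all equations between morphisms are stated up
-- to the given equivalence _≈_.

record Category (o h e : Level) : Set (suc (o ⊔ h ⊔ e)) where
  infix  4 _⇒_ _≈_
  infixr 9 _∘_
  field
    Obj     : Set o
    _⇒_     : Obj → Obj → Set h
    _≈_     : ∀ {x y} → Rel (x ⇒ y) e
    id      : ∀ {x} → x ⇒ x
    _∘_     : ∀ {x y z} → y ⇒ z → x ⇒ y → x ⇒ z
    equiv   : ∀ {x y} → IsEquivalence (_≈_ {x} {y})
    ∘-cong  : ∀ {x y z} {f f′ : y ⇒ z} {g g′ : x ⇒ y} →
              f ≈ f′ → g ≈ g′ → f ∘ g ≈ f′ ∘ g′
    idˡ     : ∀ {x y} (f : x ⇒ y) → id ∘ f ≈ f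
    idʳ     : ∀ {x y} (f : x ⇒ y) → f ∘ id ≈ f
    assoc   : ∀ {w x y z} (f : y ⇒ z) (g : x ⇒ y) (k : w ⇒ x) →
              (f ∘ g) ∘ k ≈ f ∘ (g ∘ k)

  module Equiv {x y} = IsEquivalence (equiv {x} {y})

op : ∀ {o h e} → Category o h e → Category o h e
op 𝒞 = record
  { Obj    = Obj
  ; _⇒_    = λ x y → y ⇒ x
  ; _≈_    = _≈_
  ; id     = id
  ; _∘_    = λ f g → g ∘ f
  ; equiv  = equiv
  ; ∘-cong = λ p q → ∘-cong q p
  ; idˡ    = idʳ
  ; idʳ    = idˡ
  ; assoc  = λ f g k → Equiv.sym (assoc k g f)
  }
  where open Category 𝒞

record Functor {o h e o′ h′ e′} (𝒞 : Category o h e) (𝒟 : Category o′ h′ e′)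
       : Set (o ⊔ h ⊔ e ⊔ o′ ⊔ h′ ⊔ e′) where
  private
    module 𝒞 = Category 𝒞
    module 𝒟 = Category 𝒟
  field
    F₀      : 𝒞.Obj → 𝒟.Obj
    F₁      : ∀ {x y} → x 𝒞.⇒ y → F₀ x 𝒟.⇒ F₀ y
    F₁-cong : ∀ {x y} {f g : x 𝒞.⇒ y} → f 𝒞.≈ g → F₁ f 𝒟.≈ F₁ g
    F₁-id   : ∀ {x} → F₁ (𝒞.id {x}) 𝒟.≈ 𝒟.id
    F₁-∘    : ∀ {x y z} (f : y 𝒞.⇒ z) (g : x 𝒞.⇒ y) →
              F₁ (f 𝒞.∘ g) 𝒟.≈ F₁ f 𝒟.∘ F₁ g

record NaturalTransformation
       {o h e o′ h′ e′} {𝒞 : Category o h e} {𝒟 : Category o′ h′ e′}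
       (F G : Functor 𝒞 𝒟) : Set (o ⊔ h ⊔ h′ ⊔ e′) where
  private
    module 𝒞 = Category 𝒞
    module 𝒟 = Category 𝒟
    module F = Functor F
    module G = Functor G
  field
    η       : ∀ x → F.F₀ x 𝒟.⇒ G.F₀ x
    natural : ∀ {x y} (f : x 𝒞.⇒ y) → η y 𝒟.∘ F.F₁ f 𝒟.≈ G.F₁ f 𝒟.∘ η x

module _ {o h e o′ h′ e′} (𝒞 : Category o h e) (𝒟 : Category o′ h′ e′) where
  private
    module 𝒞 = Category 𝒞
    module 𝒟 = Category 𝒟
    open 𝒟.Equiv
    open Functor
    open NaturalTransformation

    idNT : {F : Functor 𝒞 𝒟} → NaturalTransformation F F
    idNT .η       x = 𝒟.id
    idNT .natural f = trans (𝒟.idˡ _) (sym (𝒟.idʳ _))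

    _∘NT_ : {F G H : Functor 𝒞 𝒟} →
            NaturalTransformation G H → NaturalTransformation F G →
            NaturalTransformation F H
    (β ∘NT α) .η       x = η β x 𝒟.∘ η α x
    (β ∘NT α) .natural f =
      trans (𝒟.assoc _ _ _)
      (trans (𝒟.∘-cong refl (natural α f))
      (trans (sym (𝒟.assoc _ _ _))
      (trans (𝒟.∘-cong (natural β f) refl)
             (𝒟.assoc _ _ _))))

  FunctorCategory : Category (o ⊔ h ⊔ e ⊔ o′ ⊔ h′ ⊔ e′) (o ⊔ h ⊔ h′ ⊔ e′) (o ⊔ e′)
  FunctorCategory = record
    { Obj    = Functor 𝒞 𝒟
    ; _⇒_    = NaturalTransformation
    ; _≈_    = λ α β → ∀ x → η α x 𝒟.≈ η β x
    ; id     = idNT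
    ; _∘_    = _∘NT_
    ; equiv  = record
      { refl  = λ x → refl
      ; sym   = λ p x → sym (p x)
      ; trans = λ p q x → trans (p x) (q x)
      }
    ; ∘-cong = λ p q x → 𝒟.∘-cong (p x) (q x)
    ; idˡ    = λ α x → 𝒟.idˡ (η α x)
    ; idʳ    = λ α x → 𝒟.idʳ (η α x)
    ; assoc  = λ α β γ x → 𝒟.assoc (η α x) (η β x) (η γ x)
    }

-- The category of sets and functions, a set being a setoid: function
-- extensionality and quotients, which Agda's types lack, hold here.
Sets : ∀ ℓ → Category (suc ℓ) ℓ ℓ
Sets ℓ = record
  { Obj    = Setoid ℓ ℓ
  ; _⇒_    = Func
  ; _≈_    = λ {A} {B} → Setoid._≈_ (FuncEquality.setoid A B)
  ; id     = λ {A} → Identity.function A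
  ; _∘_    = λ g f → Composition.function f g
  ; equiv  = λ {A} {B} → Setoid.isEquivalence (FuncEquality.setoid A B)
  ; ∘-cong = λ {_} {_} {C} {f} p q x →
               Setoid.trans C (Func.cong f (q x)) (p _)
  ; idˡ    = λ {_} {B} f x → Setoid.refl B
  ; idʳ    = λ {_} {B} f x → Setoid.refl B
  ; assoc  = λ {_} {_} {_} {D} f g k x → Setoid.refl D
  }

-- ℂ is small relative to Sets ℓ.
Presheaves : ∀ {ℓ} → Category ℓ ℓ ℓ → Category (suc ℓ) ℓ ℓ
Presheaves {ℓ} ℂ = FunctorCategory (op ℂ) (Sets ℓ)

------------------------------------------------------------------------
-- Limits of monomorphisms and their preservation

module _ {o h e} (𝒞 : Category o h e) where
  open Category 𝒞

  IsMono : ∀ {A B} → A ⇒ B → Set (o ⊔ h ⊔ e)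
  IsMono {A} m = ∀ {X} (f g : X ⇒ A) → m ∘ f ≈ m ∘ g → f ≈ g

  IsIso : ∀ {A B} → A ⇒ B → Set (h ⊔ e)
  IsIso {A} {B} f = ∃[ g ] (g ∘ f ≈ id {A}) × (f ∘ g ≈ id {B})

  -- p : P ⇒ A and q : P ⇒ B exhibit P as the pullback of f and g.
  record IsPullback {A B C P} (p : P ⇒ A) (q : P ⇒ B) (f : A ⇒ C) (g : B ⇒ C)
         : Set (o ⊔ h ⊔ e) where
    field
      commute   : f ∘ p ≈ g ∘ q
      universal : ∀ {X} (r : X ⇒ A) (s : X ⇒ B) → f ∘ r ≈ g ∘ s →
                  ∃! _≈_ λ (u : X ⇒ P) → (p ∘ u ≈ r) × (q ∘ u ≈ s)

  -- The leg p : P ⇒ B into the common codomain is part of the cone, so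
  -- that the wide pullback of the empty family is B itself.
  record IsWidePullback {i} {I : Set i} {A : I → Obj} {B P}
         (p : P ⇒ B) (π : ∀ k → P ⇒ A k) (m : ∀ k → A k ⇒ B)
         : Set (i ⊔ o ⊔ h ⊔ e) where
    field
      commute   : ∀ k → m k ∘ π k ≈ p
      universal : ∀ {X} (q : X ⇒ B) (ρ : ∀ k → X ⇒ A k) →
                  (∀ k → m k ∘ ρ k ≈ q) →
                  ∃! _≈_ λ (u : X ⇒ P) → (p ∘ u ≈ q) × (∀ k → π k ∘ u ≈ ρ k)

module _ {o h e} {𝒞 : Category o h e} (F : Functor 𝒞 𝒞) where
  open Category 𝒞
  open Functor F

  -- Index sets are of the size of the hom-sets.
  PreservesIntersections : Set (o ⊔ suc h ⊔ e)
  PreservesIntersections =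
    ∀ {I : Set h} {A : I → Obj} {B P}
      (p : P ⇒ B) (π : ∀ k → P ⇒ A k) (m : ∀ k → A k ⇒ B) →
    (∀ k → IsMono 𝒞 (m k)) →
    IsWidePullback 𝒞 p π m →
    IsWidePullback 𝒞 (F₁ p) (λ k → F₁ (π k)) (λ k → F₁ (m k))

  PreservesInverseImages : Set (o ⊔ h ⊔ e)
  PreservesInverseImages =
    ∀ {A B X P} (p : P ⇒ X) (q : P ⇒ A) (f : X ⇒ B) (m : A ⇒ B) →
    IsMono 𝒞 m →
    IsPullback 𝒞 p q f m →
    IsPullback 𝒞 (F₁ p) (F₁ q) (F₁ f) (F₁ m)

------------------------------------------------------------------------
-- Coalgebras

  IsCaMorphism : ∀ {C A} → C ⇒ F₀ C → F₀ A ⇒ A → C ⇒ A → Set e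
  IsCaMorphism c a i = i ≈ a ∘ F₁ i ∘ c

  IsRecursive : ∀ {C} → C ⇒ F₀ C → Set (o ⊔ h ⊔ e)
  IsRecursive c = ∀ {A} (a : F₀ A ⇒ A) → ∃! _≈_ (IsCaMorphism c a)

  IsWellFounded : ∀ {C} → C ⇒ F₀ C → Set (o ⊔ h ⊔ e)
  IsWellFounded {C} c =
    ∀ {A} (i : A ⇒ C) → IsMono 𝒞 i →
    (∃[ b ] IsPullback 𝒞 b i (F₁ i) c) →
    IsIso 𝒞 i

------------------------------------------------------------------------
-- Subpresheaves

module _ {ℓ} {ℂ : Category ℓ ℓ ℓ} where
  private
    module ℂ = Category ℂ
    module Psh = Category (Presheaves ℂ)
    open Functor
    open NaturalTransformation

  ∣_∣ : Psh.Obj → ℂ.Obj → Set ℓ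
  ∣ C ∣ x = Setoid.Carrier (F₀ C x)

  infix 4 _[_≈_]
  _[_≈_] : (C : Psh.Obj) {x : ℂ.Obj} → ∣ C ∣ x → ∣ C ∣ x → Set ℓ
  C [ n ≈ n′ ] = Setoid._≈_ (F₀ C _) n n′

  restrict : (C : Psh.Obj) {x y : ℂ.Obj} → y ℂ.⇒ x → ∣ C ∣ x → ∣ C ∣ y
  restrict C f = Func.to (F₁ C f)

  component : {C D : Psh.Obj} → C Psh.⇒ D → (x : ℂ.Obj) → ∣ C ∣ x → ∣ D ∣ x
  component α x = Func.to (η α x)

  record Subpresheaf (p : Level) (C : Psh.Obj) : Set (ℓ ⊔ suc p) where
    field
      Member   : ∀ x → ∣ C ∣ x → Set p
      respects : ∀ {x} {n n′ : ∣ C ∣ x} → C [ n ≈ n′ ] → Member x n → Member x n′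
      closed   : ∀ {x y} (f : y ℂ.⇒ x) {n : ∣ C ∣ x} →
                 Member x n → Member y (restrict C f n)

  open Subpresheaf

  ⋂ : ∀ {i p} {C : Psh.Obj} {I : Set i} →
      (I → Subpresheaf p C) → Subpresheaf (i ⊔ p) C
  ⋂ B .Member   x n   = ∀ k → B k .Member x n
  ⋂ B .respects eq ns = λ k → B k .respects eq (ns k)
  ⋂ B .closed   f ns  = λ k → B k .closed f (ns k)

  toPresheaf : {C : Psh.Obj} → Subpresheaf ℓ C → Psh.Obj
  toPresheaf {C} B = record
    { F₀      = λ x → record
      { Carrier       = Σ[ n ∈ ∣ C ∣ x ] B .Member x n
      ; _≈_           = λ s t → C [ proj₁ s ≈ proj₁ t ]
      ; isEquivalence = record
        { refl  = Setoid.refl (F₀ C x)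
        ; sym   = Setoid.sym (F₀ C x)
        ; trans = Setoid.trans (F₀ C x)
        }
      }
    ; F₁      = λ f → record
      { to   = λ s → restrict C f (proj₁ s) , B .closed f (proj₂ s)
      ; cong = Func.cong (F₁ C f)
      }
    ; F₁-cong = λ f≈g s → F₁-cong C f≈g (proj₁ s)
    ; F₁-id   = λ s → F₁-id C (proj₁ s)
    ; F₁-∘    = λ f g s → F₁-∘ C f g (proj₁ s)
    }

  inclusion : {C : Psh.Obj} (B : Subpresheaf ℓ C) → toPresheaf B Psh.⇒ C
  inclusion {C} B .η       x = record { to = proj₁ ; cong = λ eq → eq }
  inclusion {C} B .natural {y = y} f _ = Setoid.refl (F₀ C y)

------------------------------------------------------------------------
-- The graph of a coalgebra

record DirectedGraph (v e : Level) : Set (suc (v ⊔ e)) where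
  infix 4 _⟶_
  field
    Node : Set v
    _⟶_  : Rel Node e

IsInfinitePath : ∀ {v e} (G : DirectedGraph v e) → (ℕ → DirectedGraph.Node G) → Set e
IsInfinitePath G p = ∀ k → p k ⟶ p (ℕ.suc k)
  where open DirectedGraph G

IsWellFoundedGraph : ∀ {v e} → DirectedGraph v e → Set (v ⊔ e)
IsWellFoundedGraph G = ¬ (∃[ p ] IsInfinitePath G p)

module _ {ℓ} {ℂ : Category ℓ ℓ ℓ} (F : Functor (Presheaves ℂ) (Presheaves ℂ)) where
  private
    module ℂ = Category ℂ
    module Psh = Category (Presheaves ℂ)
    open Functor F

  -- w ∈ F(B)(x), where F(B)(x) is regarded as a subset of F(C)(x): it is
  -- the image of the component at x of F applied to the inclusion B ↪ C.
  InF : {C : Psh.Obj} (B : Subpresheaf ℓ C) (x : ℂ.Obj) → ∣ F₀ C ∣ x → Set ℓ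
  InF {C} B x w =
    Σ[ z ∈ ∣ F₀ (toPresheaf B) ∣ x ] F₀ C [ component (F₁ (inclusion B)) x z ≈ w ]

  -- The family of all subpresheaves of C is indexed by a type in
  -- Set (suc ℓ), hence so is membership in the intersection.
  least : {C : Psh.Obj} (c : C Psh.⇒ F₀ C) (x : ℂ.Obj) (n : ∣ C ∣ x) →
          Subpresheaf (suc ℓ) C
  least {C} c x n =
    ⋂ {I = Σ[ B ∈ Subpresheaf ℓ C ] InF B x (component c x n)} proj₁

  graph : {C : Psh.Obj} → C Psh.⇒ F₀ C → DirectedGraph ℓ (suc ℓ)
  graph {C} c = record
    { Node = Σ[ x ∈ ℂ.Obj ] ∣ C ∣ x
    ; _⟶_  = λ (x , n) (y , m) → Subpresheaf.Member (least c x n) y m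
    }

{-# OPTIONS --safe #-}
module Submission where

-- Excluded middle applied to Σ-types supplies choice as well.
--
-- (1) ⇒ (2): let Ω(x) be the set of arbitrary families of truth values
-- indexed by the arrows into x.  Every subobject m of X is the pullback of
-- true : 1 → Ω along a (not necessarily unique) map χ m, and the
-- characteristic map of F true makes Ω an F-algebra.  If m is cartesian then
-- χ m is a ca-morphism, because F preserves the pullback square of χ m;
-- uniqueness of ca-morphisms gives χ m = χ id, so m is an isomorphism.
-- (2) ⇒ (3): since F preserves intersections, c n lies in F(A_n), so that
-- n is accessible iff c n ∈ F(W) for W the subpresheaf of accessible nodes.
-- Hence W is cartesian and therefore all of C.
-- (3) ⇒ (1): by well-founded recursion, i n = a (F (i|A_n) (c n)).

open import Defs
open import Level using (Level; _⊔_; suc; Lift; lift; lower)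
open import Axiom.ExcludedMiddle using (ExcludedMiddle)
open import Data.Bool.Base using (Bool; true)
open import Data.Empty using (⊥-elim)
open import Data.Nat.Base as ℕ using (ℕ)
open import Data.Product using (Σ-syntax; ∃-syntax; _×_; _,_; proj₁; proj₂)
open import Data.Unit.Polymorphic using (⊤)
open import Function.Base using (_∘_)
open import Function.Bundles using (Func; Equivalence; _⇔_; mk⇔)
open import Induction.WellFounded using (Acc; acc; WellFounded)
open import Relation.Binary.Bundles using (Setoid)
open import Relation.Binary.Core using (Rel)
open import Relation.Binary.PropositionalEquality as ≡ using (_≡_)
import Relation.Binary.Reasoning.Setoid as SetoidReasoning
open import Relation.Nullary.Decidable
  using (Dec; yes; no; does; True; toWitness; fromWitness; map′; does-⇔; dec-true;
         decidable-stable)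
open import Relation.Nullary.Negation using (¬_; contradiction)

open Functor
open NaturalTransformation
open Subpresheaf

-- Classical logic, accessibility and descending sequences.

private
  variable
    a r : Level
    P Q : Set a

does-≡⇒ : (P? : Dec P) (Q? : Dec Q) → does P? ≡ does Q? → P → Q
does-≡⇒ _        (yes q) _  _ = q
does-≡⇒ (yes _)  (no _)  ()
does-≡⇒ (no ¬p)  (no _)  _  p = contradiction p ¬p

lower-em : ∀ {ℓ} → ExcludedMiddle (suc ℓ) → ExcludedMiddle ℓ
lower-em {ℓ} em {P} = map′ lower lift (em {Lift (suc ℓ) P})

module _ {A : Set a} {_<_ : Rel A r} where

  acc-antitone : ∀ {x y} → (∀ {z} → z < y → z < x) → Acc _<_ x → Acc _<_ y
  acc-antitone sub (acc rs) = acc (λ z<y → rs (sub z<y))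

  acc⇒no-descent : ∀ {x} → Acc _<_ x →
                   (f : ℕ → A) → f 0 ≡ x → ¬ (∀ k → f (ℕ.suc k) < f k)
  acc⇒no-descent (acc rs) f ≡.refl descends =
    acc⇒no-descent (rs (descends 0)) (f ∘ ℕ.suc) ≡.refl (descends ∘ ℕ.suc)

  -- An inaccessible point has an inaccessible predecessor. Deciding the Σ-type of such predecessors
  -- returns a witness, so `step` is a function and iterating it needs no separate appeal to
  -- dependent choice.
  no-descent⇒wellFounded : ExcludedMiddle (a ⊔ r) →
                           ¬ (Σ[ f ∈ (ℕ → A) ] ∀ k → f (ℕ.suc k) < f k) →
                           WellFounded _<_
  no-descent⇒wellFounded em noDescent x = decidable-stable em λ ¬acc-x →
    noDescent ( (λ k → proj₁ (path (x , ¬acc-x) k))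
              , (λ k → proj₂ (step (path (x , ¬acc-x) k))))
    where
    Inaccessible : Set _
    Inaccessible = Σ[ y ∈ A ] ¬ Acc _<_ y

    step : ((y , _) : Inaccessible) → Σ[ (z , _) ∈ Inaccessible ] z < y
    step (y , ¬acc-y) with em {Σ[ (z , _) ∈ Inaccessible ] z < y}
    ... | yes next = next
    ... | no ¬next = ⊥-elim (¬acc-y (acc λ {z} z<y →
                       decidable-stable em λ ¬acc-z → ¬next ((z , ¬acc-z) , z<y)))

    path : Inaccessible → ℕ → Inaccessible
    path s ℕ.zero    = s
    path s (ℕ.suc k) = proj₁ (step (path s k))

-- Pullbacks, monomorphisms and ca-morphisms in an arbitrary category.

module _ {o h e} {𝒞 : Category o h e} where
  private
    module 𝒞 = Category 𝒞
  open 𝒞.Equiv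

  IsPullback-sym : ∀ {A B C P} {p : P 𝒞.⇒ A} {q : P 𝒞.⇒ B} {f : A 𝒞.⇒ C} {g : B 𝒞.⇒ C} →
                   IsPullback 𝒞 p q f g → IsPullback 𝒞 q p g f
  IsPullback-sym pb .IsPullback.commute = sym (IsPullback.commute pb)
  IsPullback-sym pb .IsPullback.universal r s gr≈fs =
    let u , (pu≈s , qu≈r) , unique = IsPullback.universal pb s r (sym gr≈fs)
    in  u , (qu≈r , pu≈s) , λ (qv≈r , pv≈s) → unique (pv≈s , qv≈r)

  id-mono : ∀ {A} → IsMono 𝒞 (𝒞.id {A})
  id-mono f g idf≈idg = trans (sym (𝒞.idˡ f)) (trans idf≈idg (𝒞.idˡ g))

  mono⇒kernelPair : ∀ {A B} {m : A 𝒞.⇒ B} → IsMono 𝒞 m → IsPullback 𝒞 𝒞.id 𝒞.id m m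
  mono⇒kernelPair mono .IsPullback.commute = refl
  mono⇒kernelPair mono .IsPullback.universal r s mr≈ms =
    r , (𝒞.idˡ r , trans (𝒞.idˡ r) (mono r s mr≈ms)) ,
    λ (v≈r , _) → trans (sym v≈r) (𝒞.idˡ _)

  -- The kernel pair of a monomorphism consists of identities and is the inverse image of `m` along
  -- itself. Its image under `F` is a pullback with equal legs, so `F₁ F m` can be cancelled.
  preserves-mono : {F : Functor 𝒞 𝒞} → PreservesInverseImages F →
                   ∀ {A B} {m : A 𝒞.⇒ B} → IsMono 𝒞 m → IsMono 𝒞 (F₁ F m)
  preserves-mono {F} inv {m = m} mono f g mf≈mg =
    let _ , (u≈f , u≈g) , _ =
          IsPullback.universal (inv 𝒞.id 𝒞.id m m mono (mono⇒kernelPair mono)) f g mf≈mg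
    in  trans (sym u≈f) u≈g

  id-cartesian : {F : Functor 𝒞 𝒞} → ∀ {C} (c : C 𝒞.⇒ F₀ F C) →
                 IsPullback 𝒞 c 𝒞.id (F₁ F 𝒞.id) c
  id-cartesian {F} c .IsPullback.commute =
    trans (𝒞.∘-cong (F₁-id F) refl) (trans (𝒞.idˡ c) (sym (𝒞.idʳ c)))
  id-cartesian {F} c .IsPullback.universal r s idr≈cs =
    s , (trans (sym idr≈cs) (trans (𝒞.∘-cong (F₁-id F) refl) (𝒞.idˡ r)) , 𝒞.idˡ s) ,
    λ (_ , v≈s) → trans (sym v≈s) (𝒞.idˡ _)

  caMorphisms-agree : {F : Functor 𝒞 𝒞} → ∀ {C} {c : C 𝒞.⇒ F₀ F C} → IsRecursive F c →
                      ∀ {A} (a : F₀ F A 𝒞.⇒ A) {i j : C 𝒞.⇒ A} →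
                      IsCaMorphism F c a i → IsCaMorphism F c a j → i 𝒞.≈ j
  caMorphisms-agree recursive a ca-i ca-j =
    let _ , _ , unique = recursive a in trans (sym (unique ca-i)) (unique ca-j)

-- Elements, images and factorisations in presheaf categories.

module _ {ℓ} (ℂ : Category ℓ ℓ ℓ) where
  private
    module ℂ = Category ℂ
    Psh = Presheaves ℂ
    module Psh = Category Psh

  ≈-refl : (A : Psh.Obj) {x : ℂ.Obj} {n : ∣ A ∣ x} → A [ n ≈ n ]
  ≈-refl A = Setoid.refl (F₀ A _)

  ≈-sym : (A : Psh.Obj) {x : ℂ.Obj} {n n′ : ∣ A ∣ x} → A [ n ≈ n′ ] → A [ n′ ≈ n ]
  ≈-sym A = Setoid.sym (F₀ A _)

  ≈-trans : (A : Psh.Obj) {x : ℂ.Obj} {n n′ n″ : ∣ A ∣ x} →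
            A [ n ≈ n′ ] → A [ n′ ≈ n″ ] → A [ n ≈ n″ ]
  ≈-trans A = Setoid.trans (F₀ A _)

  component-cong : {A B : Psh.Obj} (α : A Psh.⇒ B) {x : ℂ.Obj} {n n′ : ∣ A ∣ x} →
                   A [ n ≈ n′ ] → B [ component α x n ≈ component α x n′ ]
  component-cong α = Func.cong (η α _)

  restrict-cong : (A : Psh.Obj) {x y : ℂ.Obj} (f : y ℂ.⇒ x) {n n′ : ∣ A ∣ x} →
                  A [ n ≈ n′ ] → A [ restrict A f n ≈ restrict A f n′ ]
  restrict-cong A f = Func.cong (F₁ A f)

  representable : ℂ.Obj → Psh.Obj
  representable x = record
    { F₀      = λ y → record { Carrier = y ℂ.⇒ x ; _≈_ = ℂ._≈_ ; isEquivalence = ℂ.equiv }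
    ; F₁      = λ f → record
      { to   = λ g → g ℂ.∘ f
      ; cong = λ g≈g′ → ℂ.∘-cong g≈g′ ℂ.Equiv.refl
      }
    ; F₁-cong = λ f≈g k → ℂ.∘-cong ℂ.Equiv.refl f≈g
    ; F₁-id   = ℂ.idʳ
    ; F₁-∘    = λ f g k → ℂ.Equiv.sym (ℂ.assoc k g f)
    }

  -- The Yoneda correspondence. Universal properties are tested on these morphisms, and evaluation
  -- at `ℂ.id` turns the result back into an element.
  element : (A : Psh.Obj) {x : ℂ.Obj} → ∣ A ∣ x → representable x Psh.⇒ A
  element A n .η       y   = record
    { to   = λ f → restrict A f n
    ; cong = λ f≈g → F₁-cong A f≈g n
    }
  element A n .natural f g = F₁-∘ A f g n

  element-cong : (A : Psh.Obj) {x : ℂ.Obj} {n n′ : ∣ A ∣ x} →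
                 A [ n ≈ n′ ] → element A n Psh.≈ element A n′
  element-cong A n≈n′ y f = restrict-cong A f n≈n′

  ∘-element : {A B : Psh.Obj} (α : A Psh.⇒ B) {x : ℂ.Obj} (n : ∣ A ∣ x) →
              α Psh.∘ element A n Psh.≈ element B (component α x n)
  ∘-element α n y f = natural α f n

  IsInjective : {A B : Psh.Obj} → A Psh.⇒ B → Set ℓ
  IsInjective {A} {B} m = ∀ {x} (n n′ : ∣ A ∣ x) →
    B [ component m x n ≈ component m x n′ ] → A [ n ≈ n′ ]

  mono⇒injective : {A B : Psh.Obj} (m : A Psh.⇒ B) → IsMono Psh m → IsInjective m
  mono⇒injective {A} {B} m mono {x} n n′ mn≈mn′ =
    ≈-trans A (≈-sym A (F₁-id A n)) (≈-trans A (eq x ℂ.id) (F₁-id A n′))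
    where
    eq : element A n Psh.≈ element A n′
    eq = mono (element A n) (element A n′) λ y f →
      ≈-trans B (∘-element m n y f)
        (≈-trans B (element-cong B mn≈mn′ y f) (≈-sym B (∘-element m n′ y f)))

  injective⇒mono : {A B : Psh.Obj} (m : A Psh.⇒ B) → IsInjective m → IsMono Psh m
  injective⇒mono m inj f g mf≈mg x n = inj _ _ (mf≈mg x n)

  pullback-element : {A B C P : Psh.Obj} {p : P Psh.⇒ A} {q : P Psh.⇒ B}
    {f : A Psh.⇒ C} {g : B Psh.⇒ C} → IsPullback Psh p q f g →
    ∀ {x} {s : ∣ A ∣ x} {t : ∣ B ∣ x} → C [ component f x s ≈ component g x t ] →
    Σ[ z ∈ ∣ P ∣ x ] A [ component p x z ≈ s ] × B [ component q x z ≈ t ]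
  pullback-element {A} {B} {C} {f = f} {g} pb {x} {s} {t} fs≈gt =
    let u , (pu≈s , qu≈t) , _ = IsPullback.universal pb (element A s) (element B t) λ y k →
          ≈-trans C (∘-element f s y k)
            (≈-trans C (element-cong C fs≈gt y k) (≈-sym C (∘-element g t y k)))
    in  component u x ℂ.id
      , ≈-trans A (pu≈s x ℂ.id) (F₁-id A s)
      , ≈-trans B (qu≈t x ℂ.id) (F₁-id B t)

  widePullback-element : {I : Set ℓ} {A : I → Psh.Obj} {B P : Psh.Obj}
    {p : P Psh.⇒ B} {π : ∀ k → P Psh.⇒ A k} {m : ∀ k → A k Psh.⇒ B} →
    IsWidePullback Psh p π m →
    ∀ {x} {w : ∣ B ∣ x} (z : ∀ k → ∣ A k ∣ x) → (∀ k → B [ component (m k) x (z k) ≈ w ]) →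
    Σ[ u ∈ ∣ P ∣ x ] B [ component p x u ≈ w ]
  widePullback-element {A = A} {B} {m = m} wpb {x} {w} z mz≈w =
    let u , (pu≈w , _) , _ =
          IsWidePullback.universal wpb (element B w) (λ k → element (A k) (z k)) λ k y f →
            ≈-trans B (∘-element (m k) (z k) y f) (element-cong B (mz≈w k) y f)
    in  component u x ℂ.id , ≈-trans B (pu≈w x ℂ.id) (F₁-id B w)

  Image : {A B : Psh.Obj} → A Psh.⇒ B → Subpresheaf ℓ B
  Image {A} {B} m .Member   x w = Σ[ z ∈ ∣ A ∣ x ] B [ component m x z ≈ w ]
  Image {A} {B} m .respects w≈w′ (z , mz≈w) = z , ≈-trans B mz≈w w≈w′
  Image {A} {B} m .closed   f (z , mz≈w) =
    restrict A f z , ≈-trans B (natural m f z) (restrict-cong B f mz≈w)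

  -- Membership in `Image m` carries its preimage, so nothing has to be chosen. The preimage may
  -- vary with the representative and with restriction; injectivity of `m` makes it respect both.
  factorise : {A B X : Psh.Obj} (m : A Psh.⇒ B) → IsInjective m →
              (s : X Psh.⇒ B) → (∀ x n → Member (Image m) x (component s x n)) →
              Σ[ u ∈ X Psh.⇒ A ] m Psh.∘ u Psh.≈ s
  factorise {A} {B} {X} m inj s preimage = u , λ x n → proj₂ (preimage x n)
    where
    u : X Psh.⇒ A
    u .η x = record
      { to   = λ n → proj₁ (preimage x n)
      ; cong = λ {n} {n′} n≈n′ → inj _ _ (≈-trans B (proj₂ (preimage x n))
                 (≈-trans B (component-cong s n≈n′) (≈-sym B (proj₂ (preimage x n′)))))
      }
    u .natural {x} {y} f n = inj _ _
      (≈-trans B (proj₂ (preimage y (restrict X f n)))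
      (≈-trans B (natural s f n)
      (≈-trans B (restrict-cong B f (≈-sym B (proj₂ (preimage x n))))
                 (≈-sym B (natural m f _)))))

  bijective⇒iso : {A B : Psh.Obj} (m : A Psh.⇒ B) → IsInjective m →
                  (∀ x n → Member (Image m) x n) → IsIso Psh m
  bijective⇒iso m inj surj =
    let g , mg≈id = factorise m inj Psh.id surj
    in  g , (λ x n → inj _ _ (mg≈id x (component m x n))) , mg≈id

  Image-pullback : {A B C P : Psh.Obj} {p : P Psh.⇒ A} {q : P Psh.⇒ B}
    {f : A Psh.⇒ C} {g : B Psh.⇒ C} → IsPullback Psh p q f g →
    ∀ {x} {s : ∣ A ∣ x} → Member (Image p) x s ⇔ Member (Image g) x (component f x s)
  Image-pullback {A} {B} {C} {q = q} {f} pb {x} = mk⇔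
    (λ (z , pz≈s) → component q x z ,
      ≈-trans C (≈-sym C (IsPullback.commute pb x z)) (component-cong f pz≈s))
    (λ (t , gt≈fs) → let z , pz≈s , _ = pullback-element pb (≈-sym C gt≈fs) in z , pz≈s)

  -- A weak subobject classifier, and recursive implies well-founded.

  module _ (em : ExcludedMiddle ℓ) where

    Ω : Psh.Obj
    Ω = record
      { F₀      = λ x → record
        { Carrier       = Σ[ S ∈ (∀ y → y ℂ.⇒ x → Bool) ]
                            (∀ {y} {f g : y ℂ.⇒ x} → f ℂ.≈ g → S y f ≡ S y g)
        ; _≈_           = λ (S , _) (T , _) → ∀ y f → S y f ≡ T y f
        ; isEquivalence = record
          { refl  = λ y f → ≡.refl
          ; sym   = λ S≈T y f → ≡.sym (S≈T y f)
          ; trans = λ S≈T T≈U y f → ≡.trans (S≈T y f) (T≈U y f)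
          }
        }
      ; F₁      = λ g → record
        { to   = λ (S , S-cong) →
                   (λ y f → S y (g ℂ.∘ f)) , λ f≈f′ → S-cong (ℂ.∘-cong ℂ.Equiv.refl f≈f′)
        ; cong = λ S≈T y f → S≈T y (g ℂ.∘ f)
        }
      ; F₁-cong = λ g≈g′ (S , S-cong) y f → S-cong (ℂ.∘-cong g≈g′ ℂ.Equiv.refl)
      ; F₁-id   = λ (S , S-cong) y f → S-cong (ℂ.idˡ f)
      ; F₁-∘    = λ g h (S , S-cong) y f → S-cong (ℂ.assoc h g f)
      }

    𝟙 : Psh.Obj
    𝟙 = record
      { F₀      = λ x → record
        { Carrier       = ⊤
        ; _≈_           = λ _ _ → ⊤
        ; isEquivalence = record { refl = _ ; sym = _ ; trans = _ }
        }
      ; F₁      = λ f → record { to = _ ; cong = _ }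
      ; F₁-cong = _
      ; F₁-id   = _
      ; F₁-∘    = _
      }

    ! : {A : Psh.Obj} → A Psh.⇒ 𝟙
    ! .η       x = record { to = _ ; cong = _ }
    ! .natural   = _

    truth : 𝟙 Psh.⇒ Ω
    truth .η       x = record
      { to   = λ _ → (λ y f → true) , λ _ → ≡.refl
      ; cong = λ _ y f → ≡.refl
      }
    truth .natural f _ y g = ≡.refl

    truth-mono : IsMono Psh truth
    truth-mono = injective⇒mono truth _

    χ : {A B : Psh.Obj} → A Psh.⇒ B → B Psh.⇒ Ω
    χ {A} {B} m = record
      { η       = λ x → record
        { to   = λ n → (λ y f → does (em {Member (Image m) y (restrict B f n)}))
                     , λ f≈g → image-cong (F₁-cong B f≈g n)
        ; cong = λ n≈n′ y f → image-cong (restrict-cong B f n≈n′)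
        }
      ; natural = λ f n y g → image-cong (≈-sym B (F₁-∘ B g f n))
      }
      where
      image-cong : ∀ {y} {w w′ : ∣ B ∣ y} → B [ w ≈ w′ ] →
                   does (em {Member (Image m) y w}) ≡ does (em {Member (Image m) y w′})
      image-cong w≈w′ = does-⇔
        (mk⇔ (respects (Image m) w≈w′) (respects (Image m) (≈-sym B w≈w′))) em em

    χ-reflect : {A A′ B : Psh.Obj} (m : A Psh.⇒ B) (m′ : A′ Psh.⇒ B) {x : ℂ.Obj} {n : ∣ B ∣ x} →
                Ω [ component (χ m) x n ≈ component (χ m′) x n ] →
                Member (Image m) x n → Member (Image m′) x n
    χ-reflect {B = B} m m′ {x} {n} eq n∈m =
      respects (Image m′) (F₁-id B n)
        (does-≡⇒ em em (eq x ℂ.id) (respects (Image m) (≈-sym B (F₁-id B n)) n∈m))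

    χ-pullback : {A B : Psh.Obj} (m : A Psh.⇒ B) → IsMono Psh m →
                 IsPullback Psh m ! (χ m) truth
    χ-pullback {A} {B} m mono .IsPullback.commute x n y f =
      dec-true em (closed (Image m) f (n , ≈-refl B))
    χ-pullback {A} {B} m mono .IsPullback.universal r s χr≈true =
      let u , mu≈r = factorise m (mono⇒injective m mono) r λ x n →
            respects (Image m) (F₁-id B _)
              -- `true` is read as the decision of `⊤`, and the arrow `ℂ.id` singles out the element
              -- itself.
              (does-≡⇒ {P = ⊤ {ℓ}} (yes _) em (≡.sym (χr≈true x n x ℂ.id)) _)
      in  u , (mu≈r , _) ,
          λ {v} (mv≈r , _) → mono u v λ x n → ≈-trans B (mu≈r x n) (≈-sym B (mv≈r x n))

    module _ {F : Functor Psh Psh} (inv : PreservesInverseImages F)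
             {C : Psh.Obj} (c : C Psh.⇒ F₀ F C) where

      -- At each arrow two propositions are decided, and two pullbacks make them equivalent: an
      -- element lies in `m` iff its image under `c` lies in `F₁ F m`, iff `F₁ F (χ m)` sends that
      -- image into `F₁ F truth`.
      χ-caMorphism : {A : Psh.Obj} (m : A Psh.⇒ C) → IsMono Psh m →
                     {b : A Psh.⇒ F₀ F A} → IsPullback Psh b m (F₁ F m) c →
                     IsCaMorphism F c (χ (F₁ F truth)) (χ m)
      χ-caMorphism m mono cartesian x n y f = does-⇔ (mk⇔ to from) em em
        where
        -- The left side of the ca-equation restricts `n` along `f` first, the right side restricts
        -- last; naturality reconciles them.
        Fχc≈ : F₀ F Ω [ component (F₁ F (χ m)) y (component c y (restrict C f n))
                      ≈ restrict (F₀ F Ω) f (component (F₁ F (χ m)) x (component c x n)) ]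
        Fχc≈ = natural (F₁ F (χ m) Psh.∘ c) f n

        cartesian⇔ : ∀ {x s} → Member (Image m) x s ⇔ Member (Image (F₁ F m)) x (component c x s)
        cartesian⇔ = Image-pullback (IsPullback-sym {𝒞 = Psh} cartesian)

        Fχ⇔ : ∀ {x s} → Member (Image (F₁ F m)) x s ⇔
                        Member (Image (F₁ F truth)) x (component (F₁ F (χ m)) x s)
        Fχ⇔ = Image-pullback (inv m ! (χ m) truth truth-mono (χ-pullback m mono))

        open Equivalence using () renaming (to to ⟦_⟧; from to ⟦_⟧⁻¹)

        to : _ → _
        to = respects (Image (F₁ F truth)) Fχc≈ ∘ ⟦ Fχ⇔ ⟧ ∘ ⟦ cartesian⇔ ⟧

        from : _ → _
        from = ⟦ cartesian⇔ ⟧⁻¹ ∘ ⟦ Fχ⇔ ⟧⁻¹ ∘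
               respects (Image (F₁ F truth)) (≈-sym (F₀ F Ω) Fχc≈)

      recursive⇒wellFounded : IsRecursive F c → IsWellFounded F c
      recursive⇒wellFounded recursive m mono (_ , cartesian) =
        bijective⇒iso m (mono⇒injective m mono) λ x n →
          χ-reflect Psh.id m (χid≈χm x n) (n , ≈-refl C)
        where
        -- The identity is cartesian too, so both characteristic maps solve the same equation.
        χid≈χm : χ Psh.id Psh.≈ χ m
        χid≈χm = caMorphisms-agree {𝒞 = Psh} {F} {c = c} recursive
          (χ (F₁ F truth)) {χ Psh.id} {χ m}
          (χ-caMorphism Psh.id (id-mono {𝒞 = Psh}) (id-cartesian {𝒞 = Psh} {F} c))
          (χ-caMorphism m mono cartesian)

  -- Subpresheaves and their intersections as wide pullbacks.

  _⊆_ : ∀ {p q} {C : Psh.Obj} → Subpresheaf p C → Subpresheaf q C → Set (ℓ ⊔ p ⊔ q)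
  A ⊆ B = ∀ {x n} → Member A x n → Member B x n

  inclusion-injective : {C : Psh.Obj} (B : Subpresheaf ℓ C) → IsInjective (inclusion B)
  inclusion-injective B _ _ eq = eq

  inclusion-mono : {C : Psh.Obj} (B : Subpresheaf ℓ C) → IsMono Psh (inclusion B)
  inclusion-mono B = injective⇒mono (inclusion B) (inclusion-injective B)

  embed : {C : Psh.Obj} (A B : Subpresheaf ℓ C) → A ⊆ B → toPresheaf A Psh.⇒ toPresheaf B
  embed A B A⊆B .η x = record { to = λ (n , n∈A) → n , A⊆B n∈A ; cong = λ eq → eq }
  embed {C} A B A⊆B .natural f _ = ≈-refl C

  ⋂-widePullback : {I : Set ℓ} {C : Psh.Obj} (B : I → Subpresheaf ℓ C) →
    IsWidePullback Psh (inclusion (⋂ B)) (λ k → embed (⋂ B) (B k) (λ n∈ → n∈ k))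
                       (λ k → inclusion (B k))
  ⋂-widePullback {C = C} B .IsWidePullback.commute k x n = ≈-refl C
  ⋂-widePullback {C = C} B .IsWidePullback.universal {X} q ρ ρ≈q =
    let u , u≈q = factorise (inclusion (⋂ B)) (inclusion-injective (⋂ B)) q λ x n →
          (component q x n , λ k → respects (B k) (ρ≈q k x n) (proj₂ (component (ρ k) x n))) , ≈-refl C
    in  u , (u≈q , λ k x n → ≈-trans C (u≈q x n) (≈-sym C (ρ≈q k x n))) ,
        λ (v≈q , _) x n → ≈-trans C (u≈q x n) (≈-sym C (v≈q x n))

  -- The graph of a coalgebra, and well-founded coalgebras.

  module _ (em : ExcludedMiddle (suc ℓ)) (F : Functor Psh Psh)
           (int : PreservesIntersections F) (inv : PreservesInverseImages F)
           {C : Psh.Obj} (c : C Psh.⇒ F₀ F C) where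

    InF-mono : {A B : Subpresheaf ℓ C} → A ⊆ B →
               ∀ {x w} → InF F A x w → InF F B x w
    InF-mono {A} {B} A⊆B {x} (z , z≈w) =
      component (F₁ F (embed A B A⊆B)) x z ,
      ≈-trans (F₀ F C) (≈-sym (F₀ F C) (F₁-∘ F (inclusion B) (embed A B A⊆B) x z))
        (≈-trans (F₀ F C) (F₁-cong F (λ _ _ → ≈-refl C) x z) z≈w)

    F-inclusion-injective : (B : Subpresheaf ℓ C) → IsInjective (F₁ F (inclusion B))
    F-inclusion-injective B =
      mono⇒injective (F₁ F (inclusion B))
        (preserves-mono {𝒞 = Psh} {F} inv {m = inclusion B} (inclusion-mono B))

    Node : Set ℓ
    Node = DirectedGraph.Node (graph F c)

    -- Quantifying over subpresheaves makes this type large. Its decision both selects a witness `B`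
    -- and, through `True`, yields a small index type.
    Separated : Node → Node → Set (suc ℓ)
    Separated (x , n) (y , m) =
      Σ[ B ∈ Subpresheaf ℓ C ] InF F B x (component c x n) × ¬ Member B y m

    -- A^c_(x,n) as an intersection indexed by a set of size ℓ: one chosen B
    -- for each node that is missed by some B.
    A^ : ∀ x → ∣ C ∣ x → Subpresheaf ℓ C
    A^ x n = ⋂ {I = Σ[ v ∈ Node ] Lift ℓ (True (em {Separated (x , n) v}))}
               λ (_ , lift sep) → proj₁ (toWitness sep)

    -- If `B` missed `m`, then `(y , m)` would be an index of the intersection. The subpresheaf
    -- chosen there, possibly different from `B`, also misses `m`, yet it contains `A^ x n`.
    A^-minimal : ∀ {x n} (B : Subpresheaf ℓ C) → InF F B x (component c x n) → A^ x n ⊆ B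
    A^-minimal {x} {n} B cn∈FB {y} {m} m∈A = decidable-stable (lower-em em) λ m∉B →
      let sep = fromWitness {a? = em {Separated (x , n) (y , m)}} (B , cn∈FB , m∉B)
      in  proj₂ (proj₂ (toWitness sep)) (m∈A ((y , m) , lift sep))

    -- `F` preserves this small intersection, and the chosen subpresheaves supply compatible
    -- preimages of `component c x n`; these glue to an element of the wide pullback.
    InF-A^ : ∀ x n → InF F (A^ x n) x (component c x n)
    InF-A^ x n = widePullback-element
      (int _ _ _ (λ k → inclusion-mono (B k)) (⋂-widePullback B))
      (λ (_ , lift sep) → proj₁ (proj₁ (proj₂ (toWitness sep))))
      (λ (_ , lift sep) → proj₂ (proj₁ (proj₂ (toWitness sep))))
      where
      B : Σ[ v ∈ Node ] Lift ℓ (True (em {Separated (x , n) v})) → Subpresheaf ℓ C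
      B (_ , lift sep) = proj₁ (toWitness sep)

    A^⊆least : ∀ {x n} → A^ x n ⊆ least F c x n
    A^⊆least m∈A (B , cn∈FB) = A^-minimal B cn∈FB m∈A

    least⊆A^ : ∀ {x n} → least F c x n ⊆ A^ x n
    least⊆A^ {x} {n} m∈least = m∈least (A^ x n , InF-A^ x n)

    -- By naturality of `c`, restricting the membership of `InF-A^ x n` along `f` puts
    -- `component c y n′` into `F (A^ x n)`; minimality does the rest.
    A^-antitone : ∀ {x y n n′} (f : y ℂ.⇒ x) → C [ restrict C f n ≈ n′ ] → A^ y n′ ⊆ A^ x n
    A^-antitone {x} {y} {n} f fn≈n′ = A^-minimal (A^ x n)
      (respects (Image (F₁ F (inclusion (A^ x n))))
        (≈-trans (F₀ F C) (≈-sym (F₀ F C) (natural c f n)) (component-cong c fn≈n′))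
        (closed (Image (F₁ F (inclusion (A^ x n)))) f (InF-A^ x n)))

    -- The converse of the edge relation, with `A^` replacing `least` so that accessibility lies in
    -- `Set ℓ` and can define a `Subpresheaf ℓ C`.
    _⇠_ : Rel Node ℓ
    (y , m) ⇠ (x , n) = Member (A^ x n) y m

    Accessible : Subpresheaf ℓ C
    Accessible .Member   x n  = Acc _⇠_ (x , n)
    Accessible .respects n≈n′ =
      acc-antitone λ {_} → A^-antitone ℂ.id (≈-trans C (F₁-id C _) n≈n′)
    Accessible .closed   f    = acc-antitone λ {_} → A^-antitone f (≈-refl C)

    -- Accessibility unfolds to `A^ x n ⊆ Accessible`. Monotonicity of `InF` gives one direction,
    -- minimality of `A^ x n` the other.
    accessible⇔InF : ∀ {x n} → Acc _⇠_ (x , n) ⇔ InF F Accessible x (component c x n)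
    accessible⇔InF {x} {n} = mk⇔
      (λ { (acc rs) → InF-mono {A^ x n} {Accessible} rs (InF-A^ x n) })
      (λ cn∈FW → acc (A^-minimal Accessible cn∈FW))

    -- `accessible⇔InF` read as a pullback: its forward direction defines `b`, its backward
    -- direction the mediating morphism. The equation for the leg `b` follows by cancelling the
    -- injective `F₁ F (inclusion Accessible)`.
    accessible-cartesian :
      ∃[ b ] IsPullback Psh b (inclusion Accessible) (F₁ F (inclusion Accessible)) c
    accessible-cartesian = b , record
      { commute   = b≈
      ; universal = λ r s r≈cs →
          let u , u≈s = factorise (inclusion Accessible) (inclusion-injective Accessible) s λ x n →
                (component s x n , Equivalence.from accessible⇔InF (component r x n , r≈cs x n)) , ≈-refl C
          in  u ,
              ((λ x n → F-inclusion-injective Accessible _ _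
                 (≈-trans (F₀ F C) (b≈ x _)
                 (≈-trans (F₀ F C) (component-cong c (u≈s x n)) (≈-sym (F₀ F C) (r≈cs x n))))) ,
               u≈s) ,
              λ (_ , v≈s) x n → ≈-trans C (u≈s x n) (≈-sym C (v≈s x n))
      }
      where
      factorisation = factorise (F₁ F (inclusion Accessible)) (F-inclusion-injective Accessible)
        (c Psh.∘ inclusion Accessible) λ x (n , acc-n) → Equivalence.to accessible⇔InF acc-n
      b  = proj₁ factorisation
      b≈ = proj₂ factorisation

    wellFounded⇒accessible : IsWellFounded F c → WellFounded _⇠_
    wellFounded⇒accessible wf (x , n) =
      let g , _ , g≈id = wf (inclusion Accessible) (inclusion-mono Accessible) accessible-cartesian
      in  respects Accessible (g≈id x n) (proj₂ (component g x n))

    wellFounded⇒graph : IsWellFounded F c → IsWellFoundedGraph (graph F c)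
    wellFounded⇒graph wf (p , path) =
      acc⇒no-descent (wellFounded⇒accessible wf (p 0)) p ≡.refl (λ k → least⊆A^ (path k))

    graph⇒accessible : IsWellFoundedGraph (graph F c) → WellFounded _⇠_
    graph⇒accessible noPath = no-descent⇒wellFounded (lower-em em)
      λ (p , path) → noPath (p , λ k → A^⊆least (path k))

    -- Recursion along the graph, and the unique ca-morphism.

    module _ (A : Psh.Obj) (a : F₀ F A Psh.⇒ A) where

      c↾ : ∀ x n → ∣ F₀ F (toPresheaf (A^ x n)) ∣ x
      c↾ x n = proj₁ (InF-A^ x n)

      -- `F` can be applied only to a natural family of earlier values, so the values and their
      -- naturality are built by one mutual recursion on accessibility proofs.
      value : ∀ x n → Acc _⇠_ (x , n) → ∣ A ∣ x

      values : ∀ x n → (∀ {v} → v ⇠ (x , n) → Acc _⇠_ v) → toPresheaf (A^ x n) Psh.⇒ A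

      -- Naturality, invariance under `≈` and independence of the accessibility proof are combined
      -- here because the induction needs all three; `f = ℂ.id` gives `value-unique`.
      value-restrict : ∀ {x y n n′} (f : y ℂ.⇒ x) → C [ restrict C f n ≈ n′ ] →
        (α : Acc _⇠_ (x , n)) (β : Acc _⇠_ (y , n′)) →
        A [ restrict A f (value x n α) ≈ value y n′ β ]

      value-unique : ∀ {x n n′} → C [ n ≈ n′ ] →
        (α : Acc _⇠_ (x , n)) (β : Acc _⇠_ (x , n′)) → A [ value x n α ≈ value x n′ β ]

      value x n (acc rs) =
        component a x (component (F₁ F (values x n rs)) x (c↾ x n))

      values x n rs .η y = record
        { to   = λ (m , m∈) → value y m (rs m∈)
        ; cong = λ { {_ , m∈} {_ , m′∈} m≈m′ → value-unique m≈m′ (rs m∈) (rs m′∈) }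
        }
      values x n rs .natural f (m , m∈) =
        ≈-sym A (value-restrict f (≈-refl C) (rs m∈) (rs (closed (A^ x n) f m∈)))

      value-unique n≈n′ α β =
        ≈-trans A (≈-sym A (F₁-id A _)) (value-restrict ℂ.id (≈-trans C (F₁-id C _) n≈n′) α β)

      value-restrict {x} {y} {n} {n′} f fn≈n′ (acc rs) (acc rs′) = begin
        restrict A f (component a x (Fh (c↾ x n)))
          ≈⟨ natural a f _ ⟨
        component a y (restrict (F₀ F A) f (Fh (c↾ x n)))
          ≈⟨ component-cong a (natural (F₁ F h) f _) ⟨
        component a y (component (F₁ F h) y (restrict (F₀ F (toPresheaf (A^ x n))) f (c↾ x n)))
          ≈⟨ component-cong a (component-cong (F₁ F h) c↾-restrict) ⟩
        component a y (component (F₁ F h) y (component (F₁ F ι) y (c↾ y n′)))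
          ≈⟨ component-cong a (F₁-∘ F h ι y (c↾ y n′)) ⟨
        component a y (component (F₁ F (h Psh.∘ ι)) y (c↾ y n′))
          ≈⟨ component-cong a (F₁-cong F h∘ι≈h′ y (c↾ y n′)) ⟩
        component a y (component (F₁ F (values y n′ rs′)) y (c↾ y n′)) ∎
        where
        open SetoidReasoning (F₀ A y)
        h = values x n rs
        Fh = component (F₁ F h) x
        ι = embed (A^ y n′) (A^ x n) (A^-antitone f fn≈n′)

        h∘ι≈h′ : h Psh.∘ ι Psh.≈ values y n′ rs′
        h∘ι≈h′ z (m , m∈) =
          value-unique (≈-refl C) (rs (A^-antitone f fn≈n′ m∈)) (rs′ m∈)

        -- Both sides lift `component c y n′` along the injective `F₁ F (inclusion (A^ x n))`.
        c↾-restrict : F₀ F (toPresheaf (A^ x n))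
          [ restrict (F₀ F (toPresheaf (A^ x n))) f (c↾ x n) ≈ component (F₁ F ι) y (c↾ y n′) ]
        c↾-restrict = F-inclusion-injective (A^ x n) _ _
          (≈-trans (F₀ F C) (natural (F₁ F (inclusion (A^ x n))) f (c↾ x n))
          (≈-trans (F₀ F C) (restrict-cong (F₀ F C) f (proj₂ (InF-A^ x n)))
          (≈-trans (F₀ F C) (≈-sym (F₀ F C) (natural c f n))
          (≈-trans (F₀ F C) (component-cong c fn≈n′)
          (≈-sym (F₀ F C) (proj₂ (InF-mono {A^ y n′} {A^ x n} (A^-antitone f fn≈n′) (InF-A^ y n′))))))))

      -- Replacing `component c x n` by its lift `c↾ x n` shows that the right side of the
      -- ca-equation depends on `i` only through its restriction to `A^ x n`.
      unfold : (i : C Psh.⇒ A) → ∀ x n → A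
        [ component (a Psh.∘ F₁ F i Psh.∘ c) x n
        ≈ component a x (component (F₁ F (i Psh.∘ inclusion (A^ x n))) x (c↾ x n)) ]
      unfold i x n = component-cong a
        (≈-trans (F₀ F A) (component-cong (F₁ F i) (≈-sym (F₀ F C) (proj₂ (InF-A^ x n))))
          (≈-sym (F₀ F A) (F₁-∘ F i (inclusion (A^ x n)) x (c↾ x n))))

      fold-cong : ∀ {x n} {h h′ : toPresheaf (A^ x n) Psh.⇒ A} → h Psh.≈ h′ → A
        [ component a x (component (F₁ F h) x (c↾ x n)) ≈ component a x (component (F₁ F h′) x (c↾ x n)) ]
      fold-cong h≈h′ = component-cong a (F₁-cong F h≈h′ _ _)

      -- Uniqueness, by induction on accessibility: after `unfold`, only values at predecessors are
      -- compared.
      caMorphism≈value : {i : C Psh.⇒ A} → IsCaMorphism F c a i →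
        ∀ {x n} (α : Acc _⇠_ (x , n)) → A [ component i x n ≈ value x n α ]
      caMorphism≈value {i} ca {x} {n} (acc rs) =
        ≈-trans A (ca x n) (≈-trans A (unfold i x n)
          (fold-cong λ y (m , m∈) → caMorphism≈value {i} ca (rs m∈)))

      solution : WellFounded _⇠_ → C Psh.⇒ A
      solution wf .η x = record
        { to   = λ n → value x n (wf (x , n))
        ; cong = λ n≈n′ → value-unique n≈n′ (wf _) (wf _)
        }
      solution wf .natural f n = ≈-sym A (value-restrict f (≈-refl C) (wf _) (wf _))

      solution-caMorphism : (wf : WellFounded _⇠_) → IsCaMorphism F c a (solution wf)
      -- Matching lets `value` reduce. The predecessors then carry the proofs from `rs` instead of
      -- those from `wf`, which `value-unique` bridges.
      solution-caMorphism wf x n with acc rs ← wf (x , n) =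
        ≈-sym A (≈-trans A (unfold (solution wf) x n)
          (fold-cong λ y (m , m∈) → value-unique (≈-refl C) (wf (y , m)) (rs m∈)))

    accessible⇒recursive : WellFounded _⇠_ → IsRecursive F c
    accessible⇒recursive wf {A} a =
      solution A a wf , solution-caMorphism A a wf ,
      λ {i} ca x n → ≈-sym A (caMorphism≈value A a {i} ca (wf (x , n)))

theorem1p9 : ∀ {ℓ} → ExcludedMiddle (suc ℓ) →
    (ℂ : Category ℓ ℓ ℓ) (F : Functor (Presheaves ℂ) (Presheaves ℂ)) →
    PreservesIntersections F → PreservesInverseImages F →
    (C : Category.Obj (Presheaves ℂ))
    (c : Category._⇒_ (Presheaves ℂ) C (Functor.F₀ F C)) →
    (IsRecursive F c ⇔ IsWellFounded F c)
    × (IsWellFounded F c ⇔ IsWellFoundedGraph (graph F c))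
theorem1p9 em ℂ F int inv C c =
  mk⇔ 1⇒2 (3⇒1 ∘ 2⇒3) , mk⇔ 2⇒3 (1⇒2 ∘ 3⇒1)
  where
  1⇒2 : IsRecursive F c → IsWellFounded F c
  1⇒2 = recursive⇒wellFounded ℂ (lower-em em) {F} inv c

  2⇒3 : IsWellFounded F c → IsWellFoundedGraph (graph F c)
  2⇒3 = wellFounded⇒graph ℂ em F int inv c

  3⇒1 : IsWellFoundedGraph (graph F c) → IsRecursive F c
  3⇒1 = accessible⇒recursive ℂ em F int inv c ∘ graph⇒accessible ℂ em F int inv c
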